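{- For every $k\in\mathbb{N}$ there exists an $\mathrm{MSO}_1$ sentence $\phi_k$ such that for every graph $G$, it holds that $G\models\phi_k$ if and only if $G$ is a YES-instance of Rainbow Vertex $k$-Coloring ($k$-RVC). Similarly, for every $k\in\mathbb{N}$ there exists an $\mathrm{MSO}_2$ sentence $\psi_k$ such that for every graph $G$, it holds that $G\models\psi_k$ if and only if $G$ is a YES-instance of Rainbow $k$-Coloring ($k$-RC).
   Context: All graphs are finite, simple and undirected. $[i]=\{1,\dots,i\}$. A vertex (edge) coloring of $G=(V,E)$ is a mapping from $V$ (from $E$) to $\mathbb{N}$, not necessarily proper. A color occurs on a path $P$ if it is the color of an edge of $P$ (for edge colorings), respectively of an internal vertex of $P$ (for vertex colorings). A vertex or edge coloring is rainbow if between each pair of vertices $a,b$ there exists an $a$–$b$ path on which each color occurs at most once. $\mathrm{rc}(G)$ (resp. $\mathrm{rvc}(G)$) is the minimum $i\in\mathbb{N}$ such that there is a rainbow edge coloring $\alpha:E\to[i]$ (resp. rainbow vertex coloring $\alpha:V\to[i]$). $k$-RC: given a connected graph $G$, is $\mathrm{rc}(G)\le k$? $k$-RVC: given a connected graph $G$, is $\mathrm{rvc}(G)\le k$? In particular, a YES-instance is a connected graph satisfying the respective inequality. $\mathrm{MSO}_2$ formulas are built from atomic formulas $I(x,y)$ (vertex $x$ is incident to edge $y$), $x\in X$, $x=y$ using negation, conjunction, existential quantification over individual variables (ranging over vertices and edges) and over set variables (ranging over sets of vertices or sets of edges). $\mathrm{MSO}_1$ is defined similarly, but individual variables range only over vertices,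 set variables only over sets of vertices, and $I(x,y)$ is replaced by $E(x,y)$ (vertices $x$ and $y$ are adjacent). A sentence is a formula without free variables. -}

module Defs where

open import Data.Fin using (Fin)
open import Data.Fin.Subset using (Subset; _∈_; ∣_∣)
open import Data.List using (List; []; _∷_; map)
open import Data.List.Membership.Propositional renaming (_∈_ to _∈ˡ_) using ()
open import Data.List.Relation.Unary.All using (All; []; _∷_; lookup)
open import Data.List.Relation.Unary.Unique.Propositional using (Unique)
open import Data.Nat using (ℕ; _≤_)
open import Data.Product using (Σ-syntax; ∃-syntax; _×_)
open import Function.Definitions using (Injective)
open import Relation.Binary.PropositionalEquality using (_≡_; _≢_)
open import Relation.Nullary using (¬_)

-- Simple undirected graphs: E is a set of two-element subsets of V, where
-- V = Fin #V and the members of E are enumerated without repetition by Fin #E.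
record Graph : Set where
  field
    #V #E     : ℕ
    ends      : Fin #E → Subset #V
    ends-size : ∀ e → ∣ ends e ∣ ≡ 2
    ends-inj  : Injective _≡_ _≡_ ends

  V E : Set
  V = Fin #V
  E = Fin #E

  Incident : V → E → Set
  Incident x e = x ∈ ends e

  -- As ends e has exactly two elements, this says ends e = {x , y}.
  Joins : E → V → V → Set
  Joins e x y = x ≢ y × Incident x e × Incident y e

  Adjacent : V → V → Set
  Adjacent x y = ∃[ e ] Joins e x y

module _ (G : Graph) where
  open Graph G

  data Walk : V → V → Set where
    nil  : ∀ {x} → Walk x x
    cons : ∀ {x y z} (e : E) → Joins e x y → Walk y z → Walk x z

  vertices : ∀ {x y} → Walk x y → List V
  vertices {x} nil          = x ∷ []
  vertices {x} (cons _ _ w) = x ∷ vertices w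

  edges : ∀ {x y} → Walk x y → List E
  edges nil          = []
  edges (cons e _ w) = e ∷ edges w

  internalVertices : ∀ {x y} → Walk x y → List V
  internalVertices nil            = []
  internalVertices (cons _ _ nil) = []
  internalVertices (cons {y = y} _ _ w@(cons _ _ _)) = y ∷ internalVertices w

  IsPath : ∀ {x y} → Walk x y → Set
  IsPath w = Unique (vertices w)

  Connected : Set
  Connected = ∀ a b → Σ[ w ∈ Walk a b ] IsPath w

  RainbowEdgeColoring : {C : Set} → (E → C) → Set
  RainbowEdgeColoring α =
    ∀ a b → Σ[ w ∈ Walk a b ] IsPath w × Unique (map α (edges w))

  RainbowVertexColoring : {C : Set} → (V → C) → Set
  RainbowVertexColoring α =
    ∀ a b → Σ[ w ∈ Walk a b ] IsPath w × Unique (map α (internalVertices w))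

IsMinimum : (ℕ → Set) → ℕ → Set
IsMinimum P i = P i × (∀ j → P j → i ≤ j)

-- rc(G) = i and rvc(G) = i.  They are relations because the minimum need not
-- exist when G is disconnected.
rc_≡_ : Graph → ℕ → Set
rc G ≡ i = IsMinimum (λ j → Σ[ α ∈ (E → Fin j) ] RainbowEdgeColoring G α) i
  where open Graph G

rvc_≡_ : Graph → ℕ → Set
rvc G ≡ i = IsMinimum (λ j → Σ[ α ∈ (V → Fin j) ] RainbowVertexColoring G α) i
  where open Graph G

_-RC : ℕ → Graph → Set
(k -RC) G = Connected G × ∃[ i ] (rc G ≡ i) × i ≤ k

_-RVC : ℕ → Graph → Set
(k -RVC) G = Connected G × ∃[ i ] (rvc G ≡ i) × i ≤ k

-- Monadic second-order logic over a many-sorted signature of binary relations.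
record Signature : Set₁ where
  field
    Sort : Set
    Rel  : Sort → Sort → Set

-- Γ and Δ list the sorts of the free individual and set variables; a variable
-- is a de Bruijn index, i.e. a position in the corresponding list.
data Formula (S : Signature) (Γ Δ : List (Signature.Sort S)) : Set where
  rel  : ∀ {s t} → Signature.Rel S s t → s ∈ˡ Γ → t ∈ˡ Γ → Formula S Γ Δ
  mem  : ∀ {s} → s ∈ˡ Γ → s ∈ˡ Δ → Formula S Γ Δ
  eq   : ∀ {s} → s ∈ˡ Γ → s ∈ˡ Γ → Formula S Γ Δ
  neg  : Formula S Γ Δ → Formula S Γ Δ
  conj : Formula S Γ Δ → Formula S Γ Δ → Formula S Γ Δ
  ex   : ∀ s → Formula S (s ∷ Γ) Δ → Formula S Γ Δ
  exS  : ∀ s → Formula S Γ (s ∷ Δ) → Formula S Γ Δ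

Sentence : Signature → Set
Sentence S = Formula S [] []

record Structure (S : Signature) : Set₁ where
  open Signature S
  field
    size : Sort → ℕ
    ⟦_⟧  : ∀ {s t} → Rel s t → Fin (size s) → Fin (size t) → Set

module _ {S : Signature} (M : Structure S) where
  open Structure M

  Sat : ∀ {Γ Δ} → All (λ s → Fin (size s)) Γ → All (λ s → Subset (size s)) Δ →
        Formula S Γ Δ → Set
  Sat ρ σ (rel R x y) = ⟦ R ⟧ (lookup ρ x) (lookup ρ y)
  Sat ρ σ (mem x X)   = lookup ρ x ∈ lookup σ X
  Sat ρ σ (eq x y)    = lookup ρ x ≡ lookup ρ y
  Sat ρ σ (neg φ)     = ¬ Sat ρ σ φ
  Sat ρ σ (conj φ ψ)  = Sat ρ σ φ × Sat ρ σ ψ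
  Sat ρ σ (ex s φ)    = ∃[ v ] Sat (v ∷ ρ) σ φ
  Sat ρ σ (exS s φ)   = ∃[ A ] Sat ρ (A ∷ σ) φ

data Sort₁ : Set where
  vertex : Sort₁

data Rel₁ : Sort₁ → Sort₁ → Set where
  adj : Rel₁ vertex vertex

MSO₁ : Signature
MSO₁ = record { Sort = Sort₁ ; Rel = Rel₁ }

data Sort₂ : Set where
  vertex edge : Sort₂

data Rel₂ : Sort₂ → Sort₂ → Set where
  inc : Rel₂ vertex edge

MSO₂ : Signature
MSO₂ = record { Sort = Sort₂ ; Rel = Rel₂ }

structure₁ : Graph → Structure MSO₁
structure₁ G = record
  { size = λ { vertex → #V }
  ; ⟦_⟧  = λ { adj → Adjacent }
  } where open Graph G

structure₂ : Graph → Structure MSO₂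
structure₂ G = record
  { size = λ { vertex → #V ; edge → #E }
  ; ⟦_⟧  = λ { inc → Incident }
  } where open Graph G

_⊨₁_ : Graph → Sentence MSO₁ → Set
G ⊨₁ φ = Sat (structure₁ G) [] [] φ

_⊨₂_ : Graph → Sentence MSO₂ → Set
G ⊨₂ φ = Sat (structure₂ G) [] [] φ

{-# OPTIONS --safe #-}
module Submission where

-- A rainbow path repeats no colour, so with k colours its colour sequence is one
-- of finitely many duplicate-free lists L over Fin k. For a fixed L, "some walk
-- from a to b has colour sequence L" is expressible by recursion on L, and walks
-- suffice because a walk shortens to a path whose colour sequence is a sublist.
-- The formula guesses the k colour classes, says that they partition the coloured
-- sort, and takes the disjunction over L for all a and b. Decidability of
-- satisfaction in finite structures makes the classical connectives harmless and
-- yields the minimum number of colours constructively.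

open import Defs
open import Data.Bool using (true)
open import Data.Fin using (Fin; _≟_; zero; suc; inject≤)
open import Data.Fin.Properties using (any?; injective⇒≤; inject≤-injective)
open import Data.Fin.Subset using (Subset; _∈_)
open import Data.Fin.Subset.Properties using (anySubset?; _∈?_)
open import Data.List using (List; []; _∷_; map; filter; length; allFin; replicate; cartesianProductWith)
import Data.List as List
open import Data.List.Membership.Propositional using (find; lose) renaming (_∈_ to _∈ˡ_)
open import Data.List.Membership.Propositional.Properties
  using (∈-filter⁺; ∈-filter⁻; ∈-allFin; ∈-cartesianProductWith⁺; ∈-lookup)
import Data.List.Membership.DecPropositional as DecMembership
open import Data.List.Properties using (map-∘)
open import Data.List.Relation.Binary.Sublist.Propositional as Sublist
  using (_⊆_; []; _∷_; _∷ʳ_; ⊆-refl; ⊆-trans)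
import Data.List.Relation.Binary.Sublist.Propositional.Properties as Sublistₚ
open import Data.List.Relation.Unary.All using (All; []; _∷_; lookup)
open import Data.List.Relation.Unary.All.Properties using (¬Any⇒All¬)
open import Data.List.Relation.Unary.AllPairs using ([]; _∷_)
open import Data.List.Relation.Unary.Any as Any using (Any; here; there)
open import Data.List.Relation.Unary.Unique.Propositional using (Unique)
open import Data.List.Relation.Unary.Unique.DecPropositional using (unique?)
import Data.List.Relation.Unary.Unique.Propositional.Properties as Uniqueₚ
open import Data.Nat using (ℕ; zero; suc; _≤_; _<_; s≤s)
open import Data.Nat.Induction using (<-rec)
open import Data.Nat.Properties using (≤-refl; ≤-trans; <⇒≤; ≮⇒≥; anyUpTo?)
open import Data.Product using (_×_; Σ-syntax; ∃-syntax; _,_; proj₁; proj₂; map₂)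
open import Data.Product.Function.NonDependent.Propositional using (_×-⇔_)
open import Data.Sum using (_⊎_; inj₁; inj₂; [_,_])
open import Data.Sum.Function.Propositional using (_⊎-⇔_)
open import Data.Vec using (tabulate)
open import Data.Vec.Properties using (lookup∘tabulate; []=⇒lookup; lookup⇒[]=)
open import Function using (_∘_; _$_)
open import Function.Bundles using (_⇔_; mk⇔; Equivalence)
open import Function.Construct.Identity using (⇔-id)
open import Function.Construct.Composition using () renaming (_⇔-∘_ to infixr 0 _⇔-∘_)
open import Relation.Binary.PropositionalEquality using (_≡_; refl; sym; trans; cong; subst; subst₂)
open import Relation.Nullary using (¬_; Dec; yes; no; does; contradiction)
open import Relation.Nullary.Decidable using (¬?; _×-dec_; decidable-stable; dec-true)
import Relation.Nullary.Decidable as Dec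

open Equivalence using (to; from)

-- Congruence of logical equivalence

Π-cong-⇔ : {A : Set} {P Q : A → Set} → (∀ x → P x ⇔ Q x) → (∀ x → P x) ⇔ (∀ x → Q x)
Π-cong-⇔ e = mk⇔ (λ f x → to (e x) (f x)) (λ f x → from (e x) (f x))

∃-cong-⇔ : {A : Set} {P Q : A → Set} → (∀ x → P x ⇔ Q x) → (∃[ x ] P x) ⇔ (∃[ x ] Q x)
∃-cong-⇔ e = mk⇔ (map₂ (to (e _))) (map₂ (from (e _)))

Any-cong-⇔ : {A : Set} {P Q : A → Set} {xs : List A} → (∀ x → P x ⇔ Q x) → Any P xs ⇔ Any Q xs
Any-cong-⇔ e = mk⇔ (Any.map (to (e _))) (Any.map (from (e _)))

-- Duplicate-free lists

Unique⇒lookup-injective : {A : Set} {xs : List A} → Unique xs →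
                          ∀ {i j} → List.lookup xs i ≡ List.lookup xs j → i ≡ j
Unique⇒lookup-injective (_ ∷ _)  {zero}  {zero}  _  = refl
Unique⇒lookup-injective (x∉ ∷ _) {zero}  {suc j} p = contradiction p (lookup x∉ (∈-lookup j))
Unique⇒lookup-injective (x∉ ∷ _) {suc i} {zero}  p = contradiction (sym p) (lookup x∉ (∈-lookup i))
Unique⇒lookup-injective (_ ∷ u)  {suc i} {suc j} p = cong suc (Unique⇒lookup-injective u p)

-- Pigeonhole: the positions of a duplicate-free list inject into the `k` colours. This is why lists
-- of length at most `k` exhaust all rainbow colour sequences.
Unique⇒length≤ : ∀ {k} {cs : List (Fin k)} → Unique cs → length cs ≤ k
Unique⇒length≤ u = injective⇒≤ (Unique⇒lookup-injective u)

Unique-⊆ : {A : Set} {xs ys : List A} → xs ⊆ ys → Unique ys → Unique xs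
Unique-⊆ []         []       = []
Unique-⊆ (_ ∷ʳ τ)   (_ ∷ u)  = Unique-⊆ τ u
Unique-⊆ (refl ∷ τ) (y∉ ∷ u) = Sublistₚ.All-resp-⊆ τ y∉ ∷ Unique-⊆ τ u

boundedLists : ∀ k → ℕ → List (List (Fin k))
boundedLists k zero    = [] ∷ []
boundedLists k (suc n) = [] ∷ cartesianProductWith _∷_ (allFin k) (boundedLists k n)

∈-boundedLists : ∀ {k n} (cs : List (Fin k)) → length cs ≤ n → cs ∈ˡ boundedLists k n
∈-boundedLists {n = zero}  []       _       = here refl
∈-boundedLists {n = suc n} []       _       = here refl
∈-boundedLists {n = suc n} (c ∷ cs) (s≤s l) =
  there (∈-cartesianProductWith⁺ _∷_ (∈-allFin c) (∈-boundedLists cs l))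

distinctLists : ∀ k → List (List (Fin k))
distinctLists k = filter (unique? _≟_) (boundedLists k k)

-- Converts a finite disjunction, which a formula can express, into an existential with no length
-- bound; uniqueness alone supplies the bound.
Any-distinctLists : ∀ {k} {P : List (Fin k) → Set} →
                    Any P (distinctLists k) ⇔ (∃[ cs ] Unique cs × P cs)
Any-distinctLists {k} = mk⇔
  (λ p → let cs , cs∈ , pcs = find p in
         cs , proj₂ (∈-filter⁻ (unique? _≟_) {xs = boundedLists k k} cs∈) , pcs)
  (λ (cs , u , pcs) → lose (∈-filter⁺ (unique? _≟_) (∈-boundedLists cs (Unique⇒length≤ u)) u) pcs)

-- Shortening walks to paths

module _ (G : Graph) where
  open Graph G
  open DecMembership (_≟_ {#V}) renaming (_∈?_ to _∈ˡ?_)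

  -- All vertices but the last. Unlike `internalVertices`, this satisfies a uniform recursion, and
  -- the internal vertices of a nonempty walk are the initial vertices of its tail.
  initialVertices : ∀ {x y} → Walk G x y → List V
  initialVertices nil                  = []
  initialVertices (cons {x = x} _ _ w) = x ∷ initialVertices w

  internalVertices-cons : ∀ {x y z e} {j : Joins e x y} (w : Walk G y z) →
                          internalVertices G (cons e j w) ≡ initialVertices w
  internalVertices-cons nil            = refl
  internalVertices-cons (cons _ _ w)   = cong (_ ∷_) (internalVertices-cons w)

  internal⊆initial : ∀ {x y} (w : Walk G x y) → internalVertices G w ⊆ initialVertices w
  internal⊆initial nil          = []
  internal⊆initial (cons _ _ w) = _ ∷ʳ Sublist.⊆-reflexive (internalVertices-cons w)

  suffixFrom : ∀ {x y v} (w : Walk G x y) → v ∈ˡ vertices G w →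
               Σ[ u ∈ Walk G v y ] vertices G u ⊆ vertices G w
                 × edges G u ⊆ edges G w × initialVertices u ⊆ initialVertices w
  suffixFrom nil            (here refl) = nil , ⊆-refl , ⊆-refl , ⊆-refl
  suffixFrom w@(cons _ _ _) (here refl) = w , ⊆-refl , ⊆-refl , ⊆-refl
  suffixFrom (cons _ _ w)   (there v∈)  =
    let u , vs , es , is = suffixFrom w v∈ in u , _ ∷ʳ vs , _ ∷ʳ es , _ ∷ʳ is

  -- The tail is shortened first; if the start already lies on the result, the loop is cut by
  -- keeping only the suffix from there. The claim on initial vertices carries the induction,
  -- because prepending an edge turns them into internal ones.
  shorten : ∀ {x y} (w : Walk G x y) →
            Σ[ p ∈ Walk G x y ] IsPath G p × edges G p ⊆ edges G w
              × initialVertices p ⊆ initialVertices w × internalVertices G p ⊆ internalVertices G w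
  shorten nil = nil , [] ∷ [] , [] , [] , []
  shorten (cons {x = x} e j w) with shorten w
  ... | p , path , es , is , _ with x ∈ˡ? vertices G p
  ... | no x∉ = cons e j p , ¬Any⇒All¬ _ x∉ ∷ path , refl ∷ es , refl ∷ is
              , subst₂ _⊆_ (sym (internalVertices-cons p)) (sym (internalVertices-cons w)) is
  ... | yes x∈ =
    let u , vs , es′ , is′ = suffixFrom p x∈
        is″ = ⊆-trans is′ is
    -- After the cut, the internal vertices of `u` are among its initial ones, hence among those of
    -- the old tail, which are the internal vertices of the whole walk.
    in u , Unique-⊆ vs path , _ ∷ʳ ⊆-trans es′ es , _ ∷ʳ is″
     , ⊆-trans (internal⊆initial u) (subst (_ ⊆_) (sym (internalVertices-cons w)) is″)

  rainbowEdgeWalk⇔path : ∀ {C : Set} (α : E → C) {a b} →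
    (Σ[ w ∈ Walk G a b ] Unique (map α (edges G w)))
      ⇔ (Σ[ w ∈ Walk G a b ] IsPath G w × Unique (map α (edges G w)))
  rainbowEdgeWalk⇔path α = mk⇔
    (λ (w , u) → let p , path , es , _ = shorten w in p , path , Unique-⊆ (Sublistₚ.map⁺ α es) u)
    (λ (w , _ , u) → w , u)

  rainbowVertexWalk⇔path : ∀ {C : Set} (α : V → C) {a b} →
    (Σ[ w ∈ Walk G a b ] Unique (map α (internalVertices G w)))
      ⇔ (Σ[ w ∈ Walk G a b ] IsPath G w × Unique (map α (internalVertices G w)))
  rainbowVertexWalk⇔path α = mk⇔
    (λ (w , u) → let p , path , _ , _ , is = shorten w in p , path , Unique-⊆ (Sublistₚ.map⁺ α is) u)
    (λ (w , _ , u) → w , u)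

-- Derived connectives

module _ {S : Signature} where
  open Signature S

  disj : ∀ {Γ Δ} → Formula S Γ Δ → Formula S Γ Δ → Formula S Γ Δ
  disj φ ψ = neg (conj (neg φ) (neg ψ))

  all : ∀ {Γ Δ} s → Formula S (s ∷ Γ) Δ → Formula S Γ Δ
  all s φ = neg (ex s (neg φ))

  -- The syntax has no closed atom, hence the sort needed to write falsity.
  false[_] : ∀ {Γ Δ} → Sort → Formula S Γ Δ
  false[ s ] = ex s (neg (eq (here refl) (here refl)))

  ⋁[_] : ∀ {Γ Δ} → Sort → {A : Set} → List A → (A → Formula S Γ Δ) → Formula S Γ Δ
  ⋁[ s ] []       φ = false[ s ]
  ⋁[ s ] (x ∷ xs) φ = disj (φ x) (⋁[ s ] xs φ)

module _ {S : Signature} (M : Structure S)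
         (rel? : ∀ {s t} (R : Signature.Rel S s t) x y → Dec (Structure.⟦_⟧ M R x y)) where
  open Signature S
  open Structure M

  -- Both kinds of quantifier range over finite domains, so exhaustive search decides them.
  sat? : ∀ {Γ Δ} ρ σ (φ : Formula S Γ Δ) → Dec (Sat M ρ σ φ)
  sat? ρ σ (rel R x y) = rel? R (lookup ρ x) (lookup ρ y)
  sat? ρ σ (mem x X)   = lookup ρ x ∈? lookup σ X
  sat? ρ σ (eq x y)    = lookup ρ x ≟ lookup ρ y
  sat? ρ σ (neg φ)     = ¬? (sat? ρ σ φ)
  sat? ρ σ (conj φ ψ)  = sat? ρ σ φ ×-dec sat? ρ σ ψ
  sat? ρ σ (ex s φ)    = any? λ v → sat? (v ∷ ρ) σ φ
  sat? ρ σ (exS s φ)   = anySubset? λ A → sat? ρ (A ∷ σ) φ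

  module _ {Γ Δ} {ρ : All (Fin ∘ size) Γ} {σ : All (Subset ∘ size) Δ} where

    sat-disj : ∀ φ ψ → Sat M ρ σ (disj φ ψ) ⇔ (Sat M ρ σ φ ⊎ Sat M ρ σ ψ)
    sat-disj φ ψ = mk⇔ split (λ s (¬φ , ¬ψ) → [ ¬φ , ¬ψ ] s)
      where
      split : Sat M ρ σ (disj φ ψ) → Sat M ρ σ φ ⊎ Sat M ρ σ ψ
      split h with sat? ρ σ φ
      ... | yes p = inj₁ p
      ... | no ¬p = inj₂ (decidable-stable (sat? ρ σ ψ) λ ¬q → h (¬p , ¬q))

    sat-all : ∀ {s} φ → Sat M ρ σ (all s φ) ⇔ (∀ v → Sat M (v ∷ ρ) σ φ)
    sat-all φ = mk⇔
      (λ h v → decidable-stable (sat? (v ∷ ρ) σ φ) λ ¬p → h (v , ¬p))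
      (λ h (v , ¬p) → ¬p (h v))

    -- The double negation between the two quantifiers sits under the outer negation and is absorbed
    -- there, so only the matrix `φ` has to be stable.
    sat-all-all : ∀ {s t} φ → Sat M ρ σ (all s (all t φ)) ⇔ (∀ u v → Sat M (v ∷ u ∷ ρ) σ φ)
    sat-all-all φ = mk⇔
      (λ h u v → decidable-stable (sat? (v ∷ u ∷ ρ) σ φ) λ ¬p → h (u , λ g → g (v , ¬p)))
      (λ h (u , ¬g) → ¬g λ (v , ¬p) → ¬p (h u v))

    sat-⋁ : ∀ {s} {A : Set} (xs : List A) φ →
            Sat M ρ σ (⋁[ s ] xs φ) ⇔ Any (λ x → Sat M ρ σ (φ x)) xs
    sat-⋁ []       φ = mk⇔ (λ (_ , v≢v) → contradiction refl v≢v) λ ()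
    sat-⋁ (x ∷ xs) φ =
      mk⇔ [ here , there ] (λ { (here p) → inj₁ p ; (there p) → inj₂ p })
      ⇔-∘ (⇔-id _ ⊎-⇔ sat-⋁ xs φ)
      ⇔-∘ sat-disj (φ x) (⋁[ _ ] xs φ)

-- Quantification over colourings

classVar : ∀ {T : Set} {s : T} {k} → Fin k → s ∈ˡ replicate k s
classVar zero    = here refl
classVar (suc c) = there (classVar c)

module _ {S : Signature} (s : Signature.Sort S) where

  -- Quantifiers are added from the inside, since `exS` binds the head of the set context.
  exSs : ∀ k → Formula S [] (replicate k s) → Sentence S
  exSs zero    φ = φ
  exSs (suc k) φ = exSs k (exS s φ)

  othersThan : ∀ {k} → Fin k → List (Fin k)
  othersThan c = filter (λ d → ¬? (c ≟ d)) (allFin _)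

  -- Set variable `classVar c` stands for the class of colour `c`. Excluding all other classes makes
  -- `partition` demand exactly one class per element; empty classes are allowed, as a colouring
  -- need not use every colour.
  inClass inClassOnly : ∀ {k} → Fin k → Formula S (s ∷ []) (replicate k s)
  inClass c     = mem (here refl) (classVar c)
  inClassOnly c = conj (inClass c) (neg (⋁[ s ] (othersThan c) inClass))

  partition : ∀ k → Formula S [] (replicate k s)
  partition k = all s (⋁[ s ] (allFin k) inClassOnly)

  exColouring : ∀ k → Formula S [] (replicate k s) → Sentence S
  exColouring k θ = exSs k (conj (partition k) θ)

  module _ (M : Structure S)
           (rel? : ∀ {s t} (R : Signature.Rel S s t) x y → Dec (Structure.⟦_⟧ M R x y)) where
    open Structure M

    sat-exSs : ∀ k φ → Sat M [] [] (exSs k φ) ⇔ (∃[ σ ] Sat M [] σ φ)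
    sat-exSs zero    φ = mk⇔ ([] ,_) λ { ([] , p) → p }
    sat-exSs (suc k) φ =
      mk⇔ (λ (σ , A , p) → A ∷ σ , p) (λ { (A ∷ σ , p) → σ , A , p })
      ⇔-∘ sat-exSs k (exS s φ)

    -- Stated pointwise so that it directly translates each atom `mem x (classVar c)` into a colour
    -- equation.
    ColourClasses : ∀ {k} → (Fin (size s) → Fin k) → All (Subset ∘ size) (replicate k s) → Set
    ColourClasses α σ = ∀ v c → v ∈ lookup σ (classVar c) ⇔ (α v ≡ c)

    sat-partition : ∀ {k} σ → Sat M [] σ (partition k) ⇔ (∃[ α ] ColourClasses {k} α σ)
    sat-partition {k} σ =
      -- A proof that every element has a unique class is a function, and its first projection is
      -- the colouring.
      mk⇔ (λ f → proj₁ ∘ f , proj₂ ∘ f) (λ (α , h) v → α v , h v)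
      ⇔-∘ Π-cong-⇔ (λ v → mk⇔ (find′ v) (lose′ v)
                           ⇔-∘ sat-⋁ M rel? {ρ = v ∷ []} {σ} {s} (allFin k) inClassOnly)
      ⇔-∘ sat-all M rel? {ρ = []} {σ} (⋁[ s ] (allFin k) inClassOnly)
      where
      class : Fin k → Subset (size s)
      class c = lookup σ (classVar c)

      Only : Fin (size s) → Fin k → Set
      Only v c = Sat M (v ∷ []) σ (inClassOnly c)

      find′ : ∀ v → Any (Only v) (allFin k) → ∃[ c ] ∀ d → v ∈ class d ⇔ (c ≡ d)
      find′ v any = let c , _ , v∈c , only = find any in c , λ d → mk⇔
        -- Membership in a second class `d` would make the excluded disjunction over the other
        -- colours true.
        (λ v∈d → decidable-stable (c ≟ d) λ c≢d → only $
          from (sat-⋁ M rel? (othersThan c) inClass) (lose (∈-filter⁺ _ (∈-allFin d) c≢d) v∈d))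
        λ { refl → v∈c }

      lose′ : ∀ v → (∃[ c ] ∀ d → v ∈ class d ⇔ (c ≡ d)) → Any (Only v) (allFin k)
      lose′ v (c , h) = lose (∈-allFin c) $ from (h c) refl , λ p →
        let d , d∈ , v∈d = find (to (sat-⋁ M rel? (othersThan c) inClass) p)
        in proj₂ (∈-filter⁻ (λ d → ¬? (c ≟ d)) {xs = allFin k} d∈) (to (h d) v∈d)

    classes : ∀ {k} → (Fin k → Subset (size s)) → All (Subset ∘ size) (replicate k s)
    classes {zero}  X = []
    classes {suc k} X = X zero ∷ classes (X ∘ suc)

    lookup-classes : ∀ {k} X (c : Fin k) → lookup (classes X) (classVar c) ≡ X c
    lookup-classes X zero    = refl
    lookup-classes X (suc c) = lookup-classes (X ∘ suc) c

    -- The classes are the fibres of `α`, given by their characteristic vectors.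
    colourClasses : ∀ {k} α → ∃[ σ ] ColourClasses {k} α σ
    colourClasses α = classes X , λ v c →
      subst (λ A → v ∈ A ⇔ (α v ≡ c)) (sym (lookup-classes X c)) (∈X v c)
      where
      X : _ → Subset (size s)
      X c = tabulate λ v → does (α v ≟ c)

      ∈X : ∀ v c → v ∈ X c ⇔ (α v ≡ c)
      ∈X v c = mk⇔
        (λ v∈ → does⁻ (α v ≟ c) (trans (sym (lookup∘tabulate _ v)) ([]=⇒lookup v∈)))
        (λ p → lookup⇒[]= v _ (trans (lookup∘tabulate _ v) (dec-true (α v ≟ c) p)))
        where
        does⁻ : ∀ {A : Set} (A? : Dec A) → does A? ≡ true → A
        does⁻ (yes a) _ = a

    -- Shared by the vertex and edge cases: every partition comes from a colouring and every
    -- colouring has its classes, so `θ` need only be understood on matching pairs.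
    sat-exColouring : ∀ {k} θ (Q : (Fin (size s) → Fin k) → Set) →
      (∀ {α σ} → ColourClasses α σ → Sat M [] σ θ ⇔ Q α) →
      Sat M [] [] (exColouring k θ) ⇔ (∃[ α ] Q α)
    sat-exColouring {k} θ Q θ⇔Q = mk⇔
      (λ (σ , part , p) → let α , cc = to (sat-partition σ) part in α , to (θ⇔Q cc) p)
      (λ (α , q) → let σ , cc = colourClasses α in
        σ , from (sat-partition σ) (α , cc) , from (θ⇔Q cc) q)
      ⇔-∘ sat-exSs k (conj (partition k) θ)

-- Bounding the least number of colours

-- Strong induction on `k`: bounded search either finds a smaller witness to recurse on or certifies
-- that `k` is minimal.
least : ∀ {P : ℕ → Set} → (∀ j → Dec (P j)) → ∀ k → P k → ∃[ i ] IsMinimum P i × i ≤ k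
least {P} P? = <-rec LeastBelow step
  where
  LeastBelow : ℕ → Set
  LeastBelow k = P k → ∃[ i ] IsMinimum P i × i ≤ k

  step : ∀ k → (∀ {j} → j < k → LeastBelow j) → LeastBelow k
  step k rec Pk with anyUpTo? P? k
  ... | yes (j , j<k , Pj) =
    let i , min , i≤j = rec j<k Pj in i , min , ≤-trans i≤j (<⇒≤ j<k)
  ... | no ¬smaller = k , (Pk , λ j Pj → ≮⇒≥ λ j<k → ¬smaller (j , j<k , Pj)) , ≤-refl

-- Meant for `P j` saying that `j` colours suffice and `Q` being connectedness. The minimum is found
-- by decidability; conversely, monotonicity lifts it to `k`.
least⇔ : ∀ {P : ℕ → Set} {Q : Set} → (∀ j → Dec (P j)) → (∀ {i j} → i ≤ j → P i → P j) →
         (∀ {k} → P k → Q) → ∀ k → P k ⇔ (Q × ∃[ i ] IsMinimum P i × i ≤ k)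
least⇔ P? mono P⇒Q k = mk⇔ (λ p → P⇒Q p , least P? k p) (λ (_ , i , (p , _) , i≤k) → mono i≤k p)

-- Enlarging the palette injectively keeps paths rainbow, which gives the monotonicity that `least⇔`
-- asks for.
Unique-inject≤ : ∀ {A : Set} {i j} (i≤j : i ≤ j) {α : A → Fin i} {xs : List A} →
                 Unique (map α xs) → Unique (map (λ x → inject≤ (α x) i≤j) xs)
Unique-inject≤ i≤j {xs = xs} u =
  subst Unique (sym (map-∘ xs)) (Uniqueₚ.map⁺ (inject≤-injective i≤j i≤j _ _) u)

-- Vertex colourings

-- The list prescribes the colours of all vertices but the last, matching `initialVertices`; the
-- endpoint `z` stays unconstrained.
vertexWalk : ∀ {k Γ} → List (Fin k) → vertex ∈ˡ Γ → vertex ∈ˡ Γ →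
             Formula MSO₁ Γ (replicate k vertex)
vertexWalk []       x z = eq x z
vertexWalk (c ∷ cs) x z = conj (mem x (classVar c))
  (ex vertex (conj (rel adj (there x) (here refl)) (vertexWalk cs (here refl) (there z))))

-- The first vertex of the walk is not internal, so its step is split off.
rainbowVertexWalk rainbowVertexPositiveWalk :
  ∀ k → Formula MSO₁ (vertex ∷ vertex ∷ []) (replicate k vertex)
rainbowVertexPositiveWalk k = ⋁[ vertex ] (distinctLists k) λ cs →
  -- Innermost first, the individual variables are the second vertex of the walk, its end and its
  -- start.
  ex vertex (conj (rel adj (there (there (here refl))) (here refl))
                  (vertexWalk cs (here refl) (there (here refl))))
-- The equality covers the trivial walk, which has no first step.
rainbowVertexWalk k = disj (eq (there (here refl)) (here refl)) (rainbowVertexPositiveWalk k)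

rainbowVertex : ∀ k → Formula MSO₁ [] (replicate k vertex)
rainbowVertex k = all vertex (all vertex (rainbowVertexWalk k))

module _ (G : Graph) where
  open Graph G

  rel₁? : ∀ {s t} (R : Rel₁ s t) x y → Dec (Structure.⟦_⟧ (structure₁ G) R x y)
  rel₁? adj x y = any? λ e → ¬? (x ≟ y) ×-dec x ∈? ends e ×-dec y ∈? ends e

  module _ {k} {α : V → Fin k} {σ} (cc : ColourClasses vertex (structure₁ G) rel₁? α σ) where

    VertexColouredWalk : List (Fin k) → V → V → Set
    VertexColouredWalk cs x z = Σ[ w ∈ Walk G x z ] map α (initialVertices G w) ≡ cs

    vertexColouredWalk-[] : ∀ {x z} → (x ≡ z) ⇔ VertexColouredWalk [] x z
    vertexColouredWalk-[] = mk⇔ (λ { refl → nil , refl }) (λ { (nil , _) → refl })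

    vertexColouredWalk-∷ : ∀ {c cs x z} →
      (α x ≡ c × ∃[ y ] Adjacent x y × VertexColouredWalk cs y z) ⇔ VertexColouredWalk (c ∷ cs) x z
    vertexColouredWalk-∷ = mk⇔ (λ { (refl , y , (e , j) , w , refl) → cons e j w , refl })
                 (λ { (cons e j w , refl) → refl , _ , (e , j) , w , refl })

    -- Induction on the colour list: `cc` translates the colour of the current vertex, and
    -- `vertexColouredWalk-∷` glues the step to the remaining walk.
    sat-vertexWalk : ∀ {Γ} {ρ : All _ Γ} cs x z → Sat (structure₁ G) ρ σ (vertexWalk cs x z) ⇔
                     VertexColouredWalk cs (lookup ρ x) (lookup ρ z)
    sat-vertexWalk         []       x z = vertexColouredWalk-[]
    sat-vertexWalk {ρ = ρ} (c ∷ cs) x z =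
      vertexColouredWalk-∷ ⇔-∘ (cc (lookup ρ x) c ×-⇔
                  ∃-cong-⇔ λ y → ⇔-id _ ×-⇔ sat-vertexWalk cs (here refl) (there z))

    sat-rainbowVertex : Sat (structure₁ G) [] σ (rainbowVertex k) ⇔ RainbowVertexColoring G α
    sat-rainbowVertex =
      Π-cong-⇔ (λ a → Π-cong-⇔ λ b → rainbowVertexWalk⇔path G α ⇔-∘ sat-walk a b)
      ⇔-∘ sat-all-all (structure₁ G) rel₁? {ρ = []} {σ} (rainbowVertexWalk k)
      where
      FirstStep : V → V → Set
      FirstStep a b = a ≡ b ⊎ (∃[ cs ] Unique cs × ∃[ y ] Adjacent a y × VertexColouredWalk cs y b)

      Rainbow : V → V → Set
      Rainbow a b = Σ[ w ∈ Walk G a b ] Unique (map α (internalVertices G w))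

      join : ∀ {a b} → FirstStep a b → Rainbow a b
      join (inj₁ refl) = nil , []
      join (inj₂ (_ , u , y , (e , j) , w , refl)) =
        cons e j w , subst (Unique ∘ map α) (sym (internalVertices-cons G w)) u

      split : ∀ {a b} → Rainbow a b → FirstStep a b
      split (nil , _)        = inj₁ refl
      split (cons e j w , u) =
        -- The witnessing list is the colour sequence of the tail's initial vertices.
        inj₂ (_ , subst (Unique ∘ map α) (internalVertices-cons G w) u , _ , (e , j) , w , refl)

      sat-walk : ∀ a b → Sat (structure₁ G) (b ∷ a ∷ []) σ (rainbowVertexWalk k) ⇔ Rainbow a b
      sat-walk a b =
        mk⇔ join split
        ⇔-∘ (⇔-id _ ⊎-⇔
              (Any-distinctLists
               ⇔-∘ Any-cong-⇔ (λ cs → ∃-cong-⇔ λ y → ⇔-id _ ×-⇔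
                     sat-vertexWalk {ρ = y ∷ b ∷ a ∷ []} cs (here refl) (there (here refl)))
               ⇔-∘ sat-⋁ (structure₁ G) rel₁? {ρ = b ∷ a ∷ []} {σ} {vertex} (distinctLists k) _))
        ⇔-∘ sat-disj (structure₁ G) rel₁? {ρ = b ∷ a ∷ []} {σ} (eq (there (here refl)) (here refl))
              (rainbowVertexPositiveWalk k)

  sat-RVC : ∀ k → (G ⊨₁ exColouring vertex k (rainbowVertex k))
                    ⇔ (∃[ α ] RainbowVertexColoring G {Fin k} α)
  sat-RVC k = sat-exColouring vertex (structure₁ G) rel₁? (rainbowVertex k) _ sat-rainbowVertex

  RVC⇔ : ∀ k → (∃[ α ] RainbowVertexColoring G {Fin k} α) ⇔ (k -RVC) G
  RVC⇔ = least⇔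
    -- Whether `j` colours suffice is decided by evaluating the sentence for `j` in `G`.
    (λ j → Dec.map (sat-RVC j) (sat? (structure₁ G) rel₁? [] [] (exColouring vertex j (rainbowVertex j))))
    (λ i≤j (α , r) → (λ v → inject≤ (α v) i≤j) , λ a b →
      let w , path , u = r a b in w , path , Unique-inject≤ i≤j u)
    (λ (_ , r) a b → let w , path , _ = r a b in w , path)

-- Edge colourings

-- Here every edge of the walk is coloured, so no first step is split off and the empty list already
-- covers equal endpoints.
edgeWalk : ∀ {k Γ} → List (Fin k) → vertex ∈ˡ Γ → vertex ∈ˡ Γ →
           Formula MSO₂ Γ (replicate k edge)
edgeWalk []       x z = eq x z
edgeWalk (c ∷ cs) x z = ex edge (conj (mem (here refl) (classVar c)) (ex vertex (conj
  -- With no adjacency relation in the signature, these three conjuncts spell out `Joins`; their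
  -- satisfaction unfolds to it definitionally.
  (conj (neg (eq (there (there x)) (here refl)))
        (conj (rel inc (there (there x)) (there (here refl)))
              (rel inc (here refl) (there (here refl)))))
  (edgeWalk cs (here refl) (there (there z))))))

rainbowEdgeWalk : ∀ k → Formula MSO₂ (vertex ∷ vertex ∷ []) (replicate k edge)
rainbowEdgeWalk k =
  ⋁[ vertex ] (distinctLists k) λ cs → edgeWalk cs (there (here refl)) (here refl)

rainbowEdge : ∀ k → Formula MSO₂ [] (replicate k edge)
rainbowEdge k = all vertex (all vertex (rainbowEdgeWalk k))

module _ (G : Graph) where
  open Graph G

  rel₂? : ∀ {s t} (R : Rel₂ s t) x y → Dec (Structure.⟦_⟧ (structure₂ G) R x y)
  rel₂? inc x e = x ∈? ends e

  module _ {k} {α : E → Fin k} {σ} (cc : ColourClasses edge (structure₂ G) rel₂? α σ) where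

    EdgeColouredWalk : List (Fin k) → V → V → Set
    EdgeColouredWalk cs x z = Σ[ w ∈ Walk G x z ] map α (edges G w) ≡ cs

    edgeColouredWalk-[] : ∀ {x z} → (x ≡ z) ⇔ EdgeColouredWalk [] x z
    edgeColouredWalk-[] = mk⇔ (λ { refl → nil , refl }) (λ { (nil , _) → refl })

    edgeColouredWalk-∷ : ∀ {c cs x z} →
      (∃[ e ] α e ≡ c × ∃[ y ] Joins e x y × EdgeColouredWalk cs y z) ⇔ EdgeColouredWalk (c ∷ cs) x z
    edgeColouredWalk-∷ = mk⇔ (λ { (e , refl , y , j , w , refl) → cons e j w , refl })
                 (λ { (cons e j w , refl) → e , refl , _ , j , w , refl })

    sat-edgeWalk : ∀ {Γ} {ρ : All _ Γ} cs x z → Sat (structure₂ G) ρ σ (edgeWalk cs x z) ⇔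
                   EdgeColouredWalk cs (lookup ρ x) (lookup ρ z)
    sat-edgeWalk         []       x z = edgeColouredWalk-[]
    sat-edgeWalk {ρ = ρ} (c ∷ cs) x z =
      edgeColouredWalk-∷ {x = lookup ρ x} ⇔-∘ ∃-cong-⇔ λ e → cc e c ×-⇔
                 ∃-cong-⇔ λ y → ⇔-id _ ×-⇔ sat-edgeWalk cs (here refl) (there (there z))

    sat-rainbowEdge : Sat (structure₂ G) [] σ (rainbowEdge k) ⇔ RainbowEdgeColoring G α
    sat-rainbowEdge =
      Π-cong-⇔ (λ a → Π-cong-⇔ λ b → rainbowEdgeWalk⇔path G α ⇔-∘ sat-walk a b)
      ⇔-∘ sat-all-all (structure₂ G) rel₂? {ρ = []} {σ} (rainbowEdgeWalk k)
      where
      Rainbow : V → V → Set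
      Rainbow a b = Σ[ w ∈ Walk G a b ] Unique (map α (edges G w))

      join : ∀ {a b} → (∃[ cs ] Unique cs × EdgeColouredWalk cs a b) → Rainbow a b
      join (_ , u , w , refl) = w , u

      split : ∀ {a b} → Rainbow a b → ∃[ cs ] Unique cs × EdgeColouredWalk cs a b
      split (w , u) = _ , u , w , refl

      sat-walk : ∀ a b → Sat (structure₂ G) (b ∷ a ∷ []) σ (rainbowEdgeWalk k) ⇔ Rainbow a b
      sat-walk a b =
        mk⇔ join split
        ⇔-∘ Any-distinctLists
        ⇔-∘ Any-cong-⇔ (λ cs → sat-edgeWalk {ρ = b ∷ a ∷ []} cs (there (here refl)) (here refl))
        ⇔-∘ sat-⋁ (structure₂ G) rel₂? {ρ = b ∷ a ∷ []} {σ} {vertex} (distinctLists k) _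

  sat-RC : ∀ k → (G ⊨₂ exColouring edge k (rainbowEdge k))
                   ⇔ (∃[ α ] RainbowEdgeColoring G {Fin k} α)
  sat-RC k = sat-exColouring edge (structure₂ G) rel₂? (rainbowEdge k) _ sat-rainbowEdge

  RC⇔ : ∀ k → (∃[ α ] RainbowEdgeColoring G {Fin k} α) ⇔ (k -RC) G
  RC⇔ = least⇔
    (λ j → Dec.map (sat-RC j) (sat? (structure₂ G) rel₂? [] [] (exColouring edge j (rainbowEdge j))))
    (λ i≤j (α , r) → (λ e → inject≤ (α e) i≤j) , λ a b →
      let w , path , u = r a b in w , path , Unique-inject≤ i≤j u)
    (λ (_ , r) a b → let w , path , _ = r a b in w , path)

lemma7 : ((k : ℕ) → Σ[ φ ∈ Sentence MSO₁ ] ((G : Graph) → (G ⊨₁ φ) ⇔ (k -RVC) G))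
    × ((k : ℕ) → Σ[ ψ ∈ Sentence MSO₂ ] ((G : Graph) → (G ⊨₂ ψ) ⇔ (k -RC) G))
lemma7 = (λ k → exColouring vertex k (rainbowVertex k) , λ G → RVC⇔ G k ⇔-∘ sat-RVC G k)
       , (λ k → exColouring edge k (rainbowEdge k) , λ G → RC⇔ G k ⇔-∘ sat-RC G k)
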